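{- Let $k\ge 2$, let $\alpha$ be a simple ordered rational $k$-cone in $\mathbb{R}^n$, and let $\sigma=(i,j)\in S_k$ be a transposition with $1\le i<j\le k$. (1) If $j<k$, then for every $x\in\{1,\ldots,k-1\}$ $$\operatorname{lcos}_{x,k}\alpha_\sigma=\operatorname{lcos}_{\sigma(x),k}\alpha .$$ (2) If $j=k$, then for every $x\in\{1,\ldots,k-1\}$ $$\operatorname{lcos}_{x,k}\alpha_\sigma\equiv\begin{cases}(\operatorname{lcos}_{i,k}\alpha)^{ -1} \pmod{\operatorname{lsin}_k\alpha} & \text{if } x=i,\\ -\operatorname{lcos}_{x,k}\alpha\cdot(\operatorname{lcos}_{i,k}\alpha)^{ -1} \pmod{\operatorname{lsin}_k\alpha} & \text{otherwise,}\end{cases}$$ where $(\cdot)^{ -1}$ denotes the multiplicative inverse modulo $\operatorname{lsin}_k\alpha$.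
   Context: An ordered rational $k$-cone $\alpha$ in $\mathbb{R}^n$ ($k\le n$) is given by a vertex $A_0\in\mathbb{Z}^n$ and an ordered tuple $(v_1,\ldots,v_k)$ of linearly independent primitive integer vectors (its edge vectors); as a set it is $\{A_0+\sum\lambda_iv_i:\lambda_i\ge0\}$. Let $\Gamma=\mathbb{Z}^n\cap\operatorname{span}_{\mathbb{R}}(v_1,\ldots,v_k)$. There is a unique $\mathbb{Z}$-basis $e_1,\ldots,e_k$ of $\Gamma$ such that $v_i=\sum_{j\le i}a_{j,i}e_j$ with $a_{i,i}>0$ and $0\le a_{j,i}<a_{i,i}$ for $j<i$. The upper triangular matrix $(a_{j,i})$ is denoted $\operatorname{IARCTAN}(\alpha)$ (the normalised Hermite normal form). The $i$-th integer sine is $\operatorname{lsin}_i\alpha=a_{i,i}$ and the $(j,i)$-th integer cosine ($j<i$) is $\operatorname{lcos}_{j,i}\alpha=a_{j,i}$. The integer sine of a rational $m$-cone $\beta$ with primitive edge vectors $w_1,\ldots,w_m$ is the index $\operatorname{lsin}(\beta)=[\mathbb{Z}^n\cap\operatorname{span}_{\mathbb{R}}(w_1,\ldots,w_m):\mathbb{Z}w_1+\cdots+\mathbb{Z}w_m]$. The cone $\alpha$ is simple if every $(k-1)$-dimensional face $\beta$ of $\alpha$ (the cone with vertex $A_0$ generated by $k-1$ of the vectors $v_i$) satisfies $\operatorname{lsin}(\beta)=1$. For a simple cone the integers $\operatorname{lcos}_{i,k}\alpha$, $1\le i\le k-1$, are invertible modulo $\operatorname{lsin}_k\alpha$. For $s\in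 S_k$, $\alpha_s$ denotes the $s$-transpose of $\alpha$: the cone with the same vertex and with ordered edge vectors $(v_{s(1)},\ldots,v_{s(k)})$. -}

module Defs where

open import Data.Nat.Base as ℕ using (ℕ; suc)
import Data.Nat.Properties as ℕ
open import Data.Integer.Base as ℤ using (ℤ; 0ℤ; 1ℤ)
import Data.Integer.Properties as ℤ
open import Data.Integer.Divisibility.Signed using (_∣_)
open import Data.Rational.Base as ℚ using (ℚ; 0ℚ)
import Data.Rational.Properties as ℚ
open import Data.Fin.Base using (Fin; _<_; punchIn)
open import Data.Fin.Permutation using (Permutation′; _⟨$⟩ʳ_; _⟨$⟩ˡ_; inverseˡ)
open import Data.Product.Base using (_×_; _,_; ∃-syntax)
open import Data.Vec.Functional using (Vector; map; insertAt; removeAt; rearrange)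
open import Data.Vec.Functional.Properties using (insertAt-lookup; insertAt-punchIn)
open import Relation.Binary.PropositionalEquality.Core using (_≡_; _≗_; sym; trans; cong; cong₂)
open import Relation.Unary using (Pred; _∈_)
open import Level using (0ℓ)

import Algebra.Properties.CommutativeMonoid.Sum as Sum

module ∑ℤ = Sum ℤ.+-0-commutativeMonoid
module ∑ℚ = Sum ℚ.+-0-commutativeMonoid

private
  variable
    n k : ℕ

ℤⁿ : ℕ → Set
ℤⁿ = Vector ℤ

ℚⁿ : ℕ → Set
ℚⁿ = Vector ℚ

infixl 6 _-ⁿ_
_-ⁿ_ : ℤⁿ n → ℤⁿ n → ℤⁿ n
(u -ⁿ w) t = u t ℤ.- w t

0ⁿ : ℚⁿ n
0ⁿ _ = 0ℚ

embed : ℤⁿ n → ℚⁿ n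
embed = map (λ z → z ℚ./ 1)

combℤ : Vector ℤ k → Vector (ℤⁿ n) k → ℤⁿ n
combℤ c v t = ∑ℤ.sum (λ i → c i ℤ.* v i t)

combℚ : Vector ℚ k → Vector (ℚⁿ n) k → ℚⁿ n
combℚ c v t = ∑ℚ.sum (λ i → c i ℚ.* v i t)

-- Scalars are rational.  For families of integer vectors, linear independence
-- over ℚ and over ℝ agree, and an integer vector lies in the real span of the
-- family exactly when it lies in the rational span.
LinearlyIndependent : Vector (ℚⁿ n) k → Set
LinearlyIndependent {k = k} v =
  ∀ (c : Vector ℚ k) → combℚ c v ≗ 0ⁿ → ∀ i → c i ≡ 0ℚ

Primitive : ℤⁿ n → Set
Primitive v = ∀ (d : ℤ) → (∀ t → d ∣ v t) → ℤ.∣ d ∣ ≡ 1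

Lattice : Vector (ℤⁿ n) k → Pred (ℤⁿ n) 0ℓ
Lattice {k = k} v u = ∃[ c ] embed u ≗ combℚ {k = k} c (map embed v)

ℤ-Span : Vector (ℤⁿ n) k → Pred (ℤⁿ n) 0ℓ
ℤ-Span {k = k} v u = ∃[ c ] u ≗ combℤ {k = k} c v

record IsℤBasis (Γ : Pred (ℤⁿ n) 0ℓ) (e : Vector (ℤⁿ n) k) : Set where
  field
    member      : ∀ j → e j ∈ Γ
    spanning    : ∀ u → u ∈ Γ → u ∈ ℤ-Span e
    independent : ∀ (c : Vector ℤ k) → (∀ t → combℤ c e t ≡ 0ℤ) → ∀ j → c j ≡ 0ℤ

-- [Γ : Λ] = d, through a complete irredundant system of coset representatives.
record HasIndex (Γ Λ : Pred (ℤⁿ n) 0ℓ) (d : ℕ) : Set where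
  field
    rep       : Fin d → ℤⁿ n
    rep∈Γ     : ∀ a → rep a ∈ Γ
    distinct  : ∀ a b → (rep a -ⁿ rep b) ∈ Λ → a ≡ b
    exhausted : ∀ u → u ∈ Γ → ∃[ a ] (u -ⁿ rep a) ∈ Λ

record OrderedCone (n k : ℕ) : Set where
  field
    k≤n           : k ℕ.≤ n
    vertex        : ℤⁿ n
    edge          : Vector (ℤⁿ n) k
    edgePrimitive : ∀ i → Primitive (edge i)
    independent   : LinearlyIndependent (map embed edge)

private
  independent-permute : (v : Vector (ℚⁿ n) k) (s : Permutation′ k) →
    LinearlyIndependent v → LinearlyIndependent (rearrange (s ⟨$⟩ʳ_) v)
  independent-permute v s ind c eq i =
    trans (cong c (sym (inverseˡ s))) (ind c′ eq′ (s ⟨$⟩ʳ i))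
    where
    c′ : Vector ℚ _
    c′ x = c (s ⟨$⟩ˡ x)
    eq′ : combℚ c′ v ≗ 0ⁿ
    eq′ t = trans (∑ℚ.sum-permute (λ x → c′ x ℚ.* v x t) s)
      (trans (∑ℚ.sum-cong-≗ (λ x → cong (λ y → c y ℚ.* v (s ⟨$⟩ʳ x) t) (inverseˡ s))) (eq t))

  independent-remove : (v : Vector (ℚⁿ n) (suc k)) (p : Fin (suc k)) →
    LinearlyIndependent v → LinearlyIndependent (removeAt v p)
  independent-remove v p ind c eq i =
    trans (sym (insertAt-punchIn c p 0ℚ i)) (ind c′ eq′ (punchIn p i))
    where
    c′ : Vector ℚ _
    c′ = insertAt c p 0ℚ
    eq′ : combℚ c′ v ≗ 0ⁿ
    eq′ t = trans (∑ℚ.sum-remove {i = p} (λ x → c′ x ℚ.* v x t))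
      (trans (cong₂ ℚ._+_
        (trans (cong (ℚ._* v p t) (insertAt-lookup c p 0ℚ)) (ℚ.*-zeroˡ (v p t)))
        (trans (∑ℚ.sum-cong-≗ (λ x → cong (ℚ._* v (punchIn p x) t) (insertAt-punchIn c p 0ℚ x))) (eq t)))
        (ℚ.+-identityˡ 0ℚ))

permuteCone : Permutation′ k → OrderedCone n k → OrderedCone n k
permuteCone s α = record
  { k≤n           = k≤n
  ; vertex        = vertex
  ; edge          = rearrange (s ⟨$⟩ʳ_) edge
  ; edgePrimitive = λ i → edgePrimitive (s ⟨$⟩ʳ i)
  ; independent   = independent-permute (map embed edge) s independent
  }
  where open OrderedCone α

facet : OrderedCone n (suc k) → Fin (suc k) → OrderedCone n k
facet α p = record
  { k≤n           = ℕ.≤-trans (ℕ.n≤1+n _) k≤n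
  ; vertex        = vertex
  ; edge          = removeAt edge p
  ; edgePrimitive = λ i → edgePrimitive (punchIn p i)
  ; independent   = independent-remove (map embed edge) p independent
  }
  where open OrderedCone α

-- lsin(β) = d, for the sine of the whole cone (an index), as opposed to the
-- i-th sine lsin_i below (a diagonal entry).
HasLsin : OrderedCone n k → ℕ → Set
HasLsin β d = HasIndex (Lattice edge) (ℤ-Span edge) d
  where open OrderedCone β

Simple : OrderedCone n (suc k) → Set
Simple α = ∀ p → HasLsin (facet α p) 1

-- The normalised Hermite normal form: for every cone such a basis and matrix
-- exist and are unique (not proved here), so an element of this type carries
-- the integer arctangent of α.
record IARCTAN (α : OrderedCone n k) : Set where
  open OrderedCone α
  field
    basis      : Vector (ℤⁿ n) k
    isBasis    : IsℤBasis (Lattice edge) basis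
    entry      : Fin k → Fin k → ℤ
    expansion  : ∀ i → edge i ≗ combℤ (λ j → entry j i) basis
    triangular : ∀ {j i} → i < j → entry j i ≡ 0ℤ
    positive   : ∀ i → 0ℤ ℤ.< entry i i
    normalised : ∀ {j i} → j < i → 0ℤ ℤ.≤ entry j i × entry j i ℤ.< entry i i

  lsin : Fin k → ℤ
  lsin i = entry i i

  -- The (j , i)-th integer cosine; meaningful only for j < i.
  lcos : Fin k → Fin k → ℤ
  lcos j i = entry j i

open IARCTAN public using (lsin; lcos)

infix 4 _≡_[mod_]
_≡_[mod_] : ℤ → ℤ → ℤ → Set
a ≡ b [mod m ] = m ∣ (a ℤ.- b)

_isInverseOf_mod_ : ℤ → ℤ → ℤ → Set
c isInverseOf a mod m = (a ℤ.* c) ≡ 1ℤ [mod m ]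

-- Saturation of the facet opposite to v_k forces the Hermite basis to start with
-- v_1, …, v_{k-1}, so v_k = N e_k + Σ a_x v_x with N = lsin_k, and e_k has order
-- N in Γ / ℤ⟨v⟩.  As N also annihilates Γ / ℤ⟨v⟩, which does not depend on the
-- order of the edges, N is invariant under reordering.  The relation
-- v_k − Σ a_x v_x ∈ N Γ is unique modulo N up to the coefficient of v_k, and the
-- cosines of a reordered cone are read off from it: when v_i is moved to the end,
-- the whole relation is rescaled by the inverse of a_i.
module Submission where

open import Defs
open import Data.Nat.Base as ℕ using (ℕ; zero; suc; z≤n; s≤s)
import Data.Nat.Properties as ℕ
import Data.Nat.Divisibility as ℕ∣
open import Data.Fin.Base using (Fin; zero; suc; _<_; fromℕ; punchOut)
import Data.Fin.Properties as Fin
open import Data.Fin.Induction using (<-wellFounded; Acc; acc)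
open import Data.Fin.Permutation using (Permutation′; transpose; _⟨$⟩ʳ_; _⟨$⟩ˡ_; inverseˡ)
open import Data.Integer.Base as ℤ using (ℤ; +_; +<+; 0ℤ; 1ℤ; -1ℤ; -_; _+_; _*_; _-_)
import Data.Integer.Properties as ℤ
open import Data.Integer.Divisibility.Signed using (_∣_; divides; ∣⇒∣ᵤ; ∣m⇒∣-m)
open import Data.Integer.Tactic.RingSolver using (solve-∀)
open import Data.Rational.Base as ℚ using (ℚ)
import Data.Rational.Properties as ℚ
import Data.Rational.Unnormalised.Base as ℚᵘ
import Data.Rational.Unnormalised.Properties as ℚᵘ
open import Data.Product.Base using (_×_; _,_; proj₁; proj₂; ∃-syntax)
open import Data.Vec.Functional using (Vector; map; removeAt; rearrange)
open import Function.Base using (_∘_)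
open import Relation.Binary.Definitions using (tri<; tri≈; tri>)
open import Relation.Binary.PropositionalEquality
  using (_≡_; _≢_; _≗_; refl; sym; trans; cong; cong₂; subst; module ≡-Reasoning)
open import Relation.Nullary.Decidable using (yes; no; dec-true; dec-false)
open import Relation.Nullary.Negation using (contradiction)
open import Relation.Unary using (_⊆_; _∈_)
open import Algebra.Bundles using (CommutativeRing)
import Algebra.Properties.Semiring.Sum as SemiringSum
open import Algebra.Properties.AbelianGroup ℤ.+-0-abelianGroup using () renaming (∙-cancelˡ to +-cancelˡ)

private
  module Σℤ = SemiringSum ℤ.+-*-semiring
  module Σℚ = SemiringSum (CommutativeRing.semiring ℚ.+-*-commutativeRing)

  variable
    n k l : ℕ

-- Finite sums and integer combinations of vectors.

sum-zero : (f : Vector ℤ k) → (∀ i → f i ≡ 0ℤ) → ∑ℤ.sum f ≡ 0ℤ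
sum-zero {k} f f≡0 = trans (∑ℤ.sum-cong-≗ f≡0) (∑ℤ.sum-replicate-zero k)

sum-single : (f : Vector ℤ k) (i : Fin k) → (∀ j → j ≢ i → f j ≡ 0ℤ) → ∑ℤ.sum f ≡ f i
sum-single {suc _} f i off = begin
  ∑ℤ.sum f                     ≡⟨ ∑ℤ.sum-remove {i = i} f ⟩
  f i + ∑ℤ.sum (removeAt f i)  ≡⟨ cong (_+_ (f i)) (sum-zero _ λ j → off _ (Fin.punchInᵢ≢i i j)) ⟩
  f i + 0ℤ                     ≡⟨ ℤ.+-identityʳ _ ⟩
  f i                          ∎
  where open ≡-Reasoning

sum-pair : (f : Vector ℤ k) {i j : Fin k} (i≢j : i ≢ j) →
  (∀ x → x ≢ i → x ≢ j → f x ≡ 0ℤ) → ∑ℤ.sum f ≡ f i + f j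
sum-pair {suc _} f {i} {j} i≢j off = begin
  ∑ℤ.sum f                          ≡⟨ ∑ℤ.sum-remove {i = i} f ⟩
  f i + ∑ℤ.sum (removeAt f i)       ≡⟨ cong (_+_ (f i)) (sum-single _ (punchOut i≢j) off′) ⟩
  f i + removeAt f i (punchOut i≢j) ≡⟨ cong (λ x → f i + f x) (Fin.punchIn-punchOut i≢j) ⟩
  f i + f j                         ∎
  where
  open ≡-Reasoning
  off′ : ∀ x → x ≢ punchOut i≢j → removeAt f i x ≡ 0ℤ
  off′ x x≢ = off _ (Fin.punchInᵢ≢i i x) λ eq → x≢ (Fin.punchIn-injective i x _
    (trans eq (sym (Fin.punchIn-punchOut i≢j))))

unit : Fin k → Vector ℤ k
unit i j with j Fin.≟ i
... | yes _ = 1ℤ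
... | no  _ = 0ℤ

unit-≡ : (i : Fin k) → unit i i ≡ 1ℤ
unit-≡ i with i Fin.≟ i
... | yes _   = refl
... | no  i≢i = contradiction refl i≢i

unit-≢ : {i j : Fin k} → j ≢ i → unit i j ≡ 0ℤ
unit-≢ {i = i} {j} j≢i with j Fin.≟ i
... | yes j≡i = contradiction j≡i j≢i
... | no  _   = refl

combℤ-unit : (v : Vector (ℤⁿ n) k) (i : Fin k) → combℤ (unit i) v ≗ v i
combℤ-unit v i t = begin
  combℤ (unit i) v t  ≡⟨ sum-single _ i (λ j j≢i → trans (cong (_* v j t) (unit-≢ j≢i)) (ℤ.*-zeroˡ (v j t))) ⟩
  unit i i * v i t    ≡⟨ cong (_* v i t) (unit-≡ i) ⟩
  1ℤ * v i t          ≡⟨ ℤ.*-identityˡ _ ⟩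
  v i t               ∎
  where open ≡-Reasoning

combℤ-scale : (a : ℤ) (c : Vector ℤ k) (v : Vector (ℤⁿ n) k) →
  ∀ t → a * combℤ c v t ≡ combℤ (λ i → a * c i) v t
combℤ-scale a c v t = trans (Σℤ.*-distribˡ-sum a (λ i → c i * v i t))
  (∑ℤ.sum-cong-≗ λ i → sym (ℤ.*-assoc a (c i) (v i t)))

-- Serves with `a = -1ℤ`, merging a difference of two combinations into one.
combℤ-linear : (c : Vector ℤ k) (a : ℤ) (d : Vector ℤ k) (v : Vector (ℤⁿ n) k) →
  ∀ t → combℤ (λ i → c i + a * d i) v t ≡ combℤ c v t + a * combℤ d v t
combℤ-linear c a d v t = begin
  combℤ (λ i → c i + a * d i) v t
    ≡⟨ ∑ℤ.sum-cong-≗ (λ i → ℤ.*-distribʳ-+ (v i t) (c i) (a * d i)) ⟩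
  ∑ℤ.sum (λ i → c i * v i t + a * d i * v i t)
    ≡⟨ ∑ℤ.∑-distrib-+ (λ i → c i * v i t) (λ i → a * d i * v i t) ⟩
  combℤ c v t + combℤ (λ i → a * d i) v t
    ≡⟨ cong (_+_ (combℤ c v t)) (sym (combℤ-scale a d v t)) ⟩
  combℤ c v t + a * combℤ d v t ∎
  where open ≡-Reasoning

-- Substituting for each `w y` its expansion multiplies the coefficients by the matrix `M`; the two
-- summations are exchanged.
combℤ-combℤ : (c : Vector ℤ l) (M : Fin k → Fin l → ℤ) (w : Vector (ℤⁿ n) l) (v : Vector (ℤⁿ n) k) →
  (∀ y → w y ≗ combℤ (λ z → M z y) v) →
  combℤ c w ≗ combℤ (λ z → ∑ℤ.sum (λ y → c y * M z y)) v
combℤ-combℤ c M w v w≗ t = begin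
  ∑ℤ.sum (λ y → c y * w y t)
    ≡⟨ ∑ℤ.sum-cong-≗ (λ y → trans (cong (c y *_) (w≗ y t)) (combℤ-scale (c y) (λ z → M z y) v t)) ⟩
  ∑ℤ.sum (λ y → ∑ℤ.sum (λ z → c y * M z y * v z t))
    ≡⟨ ∑ℤ.∑-comm (λ y z → c y * M z y * v z t) ⟩
  ∑ℤ.sum (λ z → ∑ℤ.sum (λ y → c y * M z y * v z t))
    ≡⟨ ∑ℤ.sum-cong-≗ (λ z → sym (Σℤ.*-distribʳ-sum (v z t) (λ y → c y * M z y))) ⟩
  combℤ (λ z → ∑ℤ.sum (λ y → c y * M z y)) v t ∎
  where open ≡-Reasoning

combℤ∈span : (c : Vector ℤ l) (w : Vector (ℤⁿ n) l) (v : Vector (ℤⁿ n) k) →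
  (∀ y → w y ∈ ℤ-Span v) → combℤ c w ∈ ℤ-Span v
combℤ∈span c w v w∈ = (λ z → ∑ℤ.sum (λ y → c y * proj₁ (w∈ y) z)) ,
  combℤ-combℤ c (λ z y → proj₁ (w∈ y) z) w v (λ y → proj₂ (w∈ y))

combℤ-permute : (s : Permutation′ k) (c : Vector ℤ k) (v : Vector (ℤⁿ n) k) →
  combℤ c (rearrange (s ⟨$⟩ʳ_) v) ≗ combℤ (rearrange (s ⟨$⟩ˡ_) c) v
combℤ-permute s c v t = sym (trans (∑ℤ.sum-permute (λ x → c (s ⟨$⟩ˡ x) * v x t) s)
  (∑ℤ.sum-cong-≗ λ x → cong (λ y → c y * v (s ⟨$⟩ʳ x) t) (inverseˡ s)))

combℚ-permute : (s : Permutation′ k) (c : Vector ℚ k) (v : Vector (ℚⁿ n) k) →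
  combℚ c (rearrange (s ⟨$⟩ʳ_) v) ≗ combℚ (rearrange (s ⟨$⟩ˡ_) c) v
combℚ-permute s c v t = sym (trans (∑ℚ.sum-permute (λ x → c (s ⟨$⟩ˡ x) ℚ.* v x t) s)
  (∑ℚ.sum-cong-≗ λ x → cong (λ y → c y ℚ.* v (s ⟨$⟩ʳ x) t) (inverseˡ s)))

-- Independence over the integers and passage to the rationals.

IndependentOverℤ : Vector (ℤⁿ n) k → Set
IndependentOverℤ {k = k} v = ∀ (c : Vector ℤ k) → (∀ t → combℤ c v t ≡ 0ℤ) → ∀ i → c i ≡ 0ℤ

independent⇒injective : (v : Vector (ℤⁿ n) k) → IndependentOverℤ v →
  (c d : Vector ℤ k) → combℤ c v ≗ combℤ d v → c ≗ d
independent⇒injective v ind c d eq i = begin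
  c i                     ≡⟨ lemma (c i) (d i) ⟩
  c i + -1ℤ * d i + d i   ≡⟨ cong (_+ d i) (ind (λ i → c i + -1ℤ * d i) eq′ i) ⟩
  0ℤ + d i                ≡⟨ ℤ.+-identityˡ _ ⟩
  d i                     ∎
  where
  open ≡-Reasoning
  lemma : ∀ x y → x ≡ x + -1ℤ * y + y
  lemma = solve-∀
  cancel : ∀ x → x + -1ℤ * x ≡ 0ℤ
  cancel = solve-∀
  eq′ : ∀ t → combℤ (λ i → c i + -1ℤ * d i) v t ≡ 0ℤ
  eq′ t = trans (combℤ-linear c -1ℤ d v t)
    (trans (cong (λ x → x + -1ℤ * combℤ d v t) (eq t)) (cancel (combℤ d v t)))

ι : ℤ → ℚ
ι z = z ℚ./ 1

ι-injective : ∀ {x y} → ι x ≡ ι y → x ≡ y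
ι-injective {x} {y} eq with ℚ.fromℚᵘ-injective {ℚᵘ.mkℚᵘ x 0} {ℚᵘ.mkℚᵘ y 0} eq
... | ℚᵘ.*≡* x*1≡y*1 = trans (sym (ℤ.*-identityʳ x)) (trans x*1≡y*1 (ℤ.*-identityʳ y))

toℚᵘ-ι : ∀ z → ℚ.toℚᵘ (ι z) ℚᵘ.≃ ℚᵘ.mkℚᵘ z 0
toℚᵘ-ι z = ℚ.toℚᵘ-fromℚᵘ (ℚᵘ.mkℚᵘ z 0)

-- Normalised sums involve a gcd, so the identity is checked on unnormalised fractions with
-- denominator 1.
ι-+ : ∀ x y → ι (x + y) ≡ ι x ℚ.+ ι y
ι-+ x y = ℚ.toℚᵘ-injective (begin-equality
  ℚ.toℚᵘ (ι (x + y))                ≃⟨ toℚᵘ-ι (x + y) ⟩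
  ℚᵘ.mkℚᵘ (x + y) 0                 ≃⟨ ℚᵘ.*≡* (lemma x y) ⟩
  ℚᵘ.mkℚᵘ x 0 ℚᵘ.+ ℚᵘ.mkℚᵘ y 0      ≃⟨ ℚᵘ.+-cong (toℚᵘ-ι x) (toℚᵘ-ι y) ⟨
  ℚ.toℚᵘ (ι x) ℚᵘ.+ ℚ.toℚᵘ (ι y)    ≃⟨ ℚ.toℚᵘ-homo-+ (ι x) (ι y) ⟨
  ℚ.toℚᵘ (ι x ℚ.+ ι y)              ∎)
  where
  open ℚᵘ.≤-Reasoning
  lemma : ∀ x y → (x + y) * 1ℤ ≡ (x * 1ℤ + y * 1ℤ) * 1ℤ
  lemma = solve-∀

ι-* : ∀ x y → ι (x * y) ≡ ι x ℚ.* ι y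
ι-* x y = ℚ.toℚᵘ-injective (begin-equality
  ℚ.toℚᵘ (ι (x * y))                ≃⟨ toℚᵘ-ι (x * y) ⟩
  ℚᵘ.mkℚᵘ x 0 ℚᵘ.* ℚᵘ.mkℚᵘ y 0      ≃⟨ ℚᵘ.*-cong (toℚᵘ-ι x) (toℚᵘ-ι y) ⟨
  ℚ.toℚᵘ (ι x) ℚᵘ.* ℚ.toℚᵘ (ι y)    ≃⟨ ℚ.toℚᵘ-homo-* (ι x) (ι y) ⟨
  ℚ.toℚᵘ (ι x ℚ.* ι y)              ∎)
  where open ℚᵘ.≤-Reasoning

ι-sum : (f : Vector ℤ k) → ι (∑ℤ.sum f) ≡ ∑ℚ.sum (map ι f)
ι-sum {zero}  f = refl
ι-sum {suc k} f = trans (ι-+ (f zero) _) (cong (ι (f zero) ℚ.+_) (ι-sum (f ∘ suc)))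

embed-combℤ : (c : Vector ℤ k) (v : Vector (ℤⁿ n) k) →
  embed (combℤ c v) ≗ combℚ (map ι c) (map embed v)
embed-combℤ c v t = trans (ι-sum (λ i → c i * v i t)) (∑ℚ.sum-cong-≗ λ i → ι-* (c i) (v i t))

independentOverℤ : (v : Vector (ℤⁿ n) k) → LinearlyIndependent (map embed v) → IndependentOverℤ v
independentOverℤ v ind c eq i = ι-injective (ind (map ι c)
  (λ t → trans (sym (embed-combℤ c v t)) (cong ι (eq t))) i)

-- Over the rationals the coefficients of `a * u` can be divided by `a`. This turns integer
-- relations into membership in the saturated lattice.
multiple∈span⇒∈lattice : (v : Vector (ℤⁿ n) k) (a : ℤ) (u : ℤⁿ n) → a ≢ 0ℤ →
  (λ t → a * u t) ∈ ℤ-Span v → u ∈ Lattice v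
multiple∈span⇒∈lattice v a u a≢0 (c , eq) = (λ i → a⁻¹ ℚ.* ι (c i)) , λ t → begin
  ι (u t)                                     ≡⟨ ℚ.*-identityˡ _ ⟨
  ℚ.1ℚ ℚ.* ι (u t)                            ≡⟨ cong (ℚ._* ι (u t)) (ℚ.*-inverseˡ (ι a)) ⟨
  a⁻¹ ℚ.* ι a ℚ.* ι (u t)                     ≡⟨ ℚ.*-assoc a⁻¹ (ι a) (ι (u t)) ⟩
  a⁻¹ ℚ.* (ι a ℚ.* ι (u t))                   ≡⟨ cong (a⁻¹ ℚ.*_) (ι-* a (u t)) ⟨
  a⁻¹ ℚ.* ι (a * u t)                         ≡⟨ cong (λ x → a⁻¹ ℚ.* ι x) (eq t) ⟩
  a⁻¹ ℚ.* ι (combℤ c v t)                     ≡⟨ cong (a⁻¹ ℚ.*_) (embed-combℤ c v t) ⟩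
  a⁻¹ ℚ.* combℚ (map ι c) (map embed v) t     ≡⟨ Σℚ.*-distribˡ-sum a⁻¹ (λ i → ι (c i) ℚ.* ι (v i t)) ⟩
  ∑ℚ.sum (λ i → a⁻¹ ℚ.* (ι (c i) ℚ.* ι (v i t))) ≡⟨ ∑ℚ.sum-cong-≗ (λ i → sym (ℚ.*-assoc a⁻¹ (ι (c i)) (ι (v i t)))) ⟩
  combℚ (λ i → a⁻¹ ℚ.* ι (c i)) (map embed v) t ∎
  where
  open ≡-Reasoning
  instance
    ιa≢0 : ℚ.NonZero (ι a)
    ιa≢0 = ℚ.≢-nonZero λ eq → a≢0 (ι-injective eq)
  a⁻¹ : ℚ
  a⁻¹ = ℚ.1/ ι a

-- Integer sine 1 as divisibility of coefficients.

unimodular⇒lattice⊆span : (v : Vector (ℤⁿ n) k) →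
  HasIndex (Lattice v) (ℤ-Span v) 1 → Lattice v ⊆ ℤ-Span v
unimodular⇒lattice⊆span {n = n} v index {u} u∈Γ
  -- The only representative `r = rep zero` need not be 0, but 0 lies in its coset too; hence
  -- `u = (u - r) - (0 - r)` is a difference of two elements of the span.
  with exhausted u u∈Γ | exhausted (λ _ → 0ℤ) 0∈Γ
  where
  open HasIndex index
  0∈Γ : (λ _ → 0ℤ) ∈ Lattice v
  0∈Γ = multiple∈span⇒∈lattice v 1ℤ (λ _ → 0ℤ) (λ ())
    ((λ _ → 0ℤ) , λ t → sym (sum-zero _ λ i → ℤ.*-zeroˡ (v i t)))
... | zero , c , u-r≗ | zero , d , 0-r≗ = (λ i → c i + -1ℤ * d i) , λ t → begin
  u t                                  ≡⟨ lemma (u t) (rep zero t) ⟩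
  u t - rep zero t + -1ℤ * (0ℤ - rep zero t) ≡⟨ cong₂ (λ x y → x + -1ℤ * y) (u-r≗ t) (0-r≗ t) ⟩
  combℤ c v t + -1ℤ * combℤ d v t      ≡⟨ combℤ-linear c -1ℤ d v t ⟨
  combℤ (λ i → c i + -1ℤ * d i) v t    ∎
  where
  open HasIndex index
  open ≡-Reasoning
  lemma : ∀ x r → x ≡ x - r + -1ℤ * (0ℤ - r)
  lemma = solve-∀

-- The facet opposite to the edge p has integer sine 1, expressed without
-- removing p from the family, so that it is invariant under reordering.
FacetSaturated : Vector (ℤⁿ n) k → Fin k → Set
FacetSaturated {n} {k} v p = ∀ (a : ℤ) (u : ℤⁿ n) (c : Vector ℤ k) → a ≢ 0ℤ → c p ≡ 0ℤ →
  (λ t → a * u t) ≗ combℤ c v → ∀ x → a ∣ c x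

-- As `c p` vanishes, `u` lies in the lattice of the facet, hence is an integer combination of its
-- edges with some coefficients `d`. Independence of these edges then gives `c = a * d` away from
-- `p`.
facet-lsin⇒saturated : (α : OrderedCone n (suc k)) (p : Fin (suc k)) →
  HasLsin (facet α p) 1 → FacetSaturated (OrderedCone.edge α) p
facet-lsin⇒saturated α p lsin≡1 a u c a≢0 cp≡0 au≗ = a∣c
  where
  open OrderedCone α
  open ≡-Reasoning
  w = removeAt edge p
  au≗′ : (λ t → a * u t) ≗ combℤ (removeAt c p) w
  au≗′ t = begin
    a * u t                                  ≡⟨ au≗ t ⟩
    combℤ c edge t                           ≡⟨ ∑ℤ.sum-remove {i = p} (λ i → c i * edge i t) ⟩
    c p * edge p t + combℤ (removeAt c p) w t ≡⟨ cong (λ x → x * edge p t + combℤ (removeAt c p) w t) cp≡0 ⟩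
    0ℤ * edge p t + combℤ (removeAt c p) w t  ≡⟨ cong (_+ combℤ (removeAt c p) w t) (ℤ.*-zeroˡ (edge p t)) ⟩
    0ℤ + combℤ (removeAt c p) w t             ≡⟨ ℤ.+-identityˡ _ ⟩
    combℤ (removeAt c p) w t                  ∎
  u∈Λ : u ∈ ℤ-Span w
  u∈Λ = unimodular⇒lattice⊆span w lsin≡1
    (multiple∈span⇒∈lattice w a u a≢0 (removeAt c p , au≗′))
  d = proj₁ u∈Λ
  c≗ad : removeAt c p ≗ (λ i → a * d i)
  c≗ad = independent⇒injective w (independentOverℤ w (OrderedCone.independent (facet α p))) _ _
    λ t → trans (sym (au≗′ t)) (trans (cong (a *_) (proj₂ u∈Λ t)) (combℤ-scale a d w t))
  a∣c : ∀ x → a ∣ c x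
  a∣c x with p Fin.≟ x
  ... | yes refl = divides 0ℤ cp≡0
  ... | no p≢x   = subst (λ y → a ∣ c y) (Fin.punchIn-punchOut p≢x)
    (divides (d (punchOut p≢x)) (trans (c≗ad (punchOut p≢x)) (ℤ.*-comm a _)))

-- Saturation, spans and lattices under reordering of the edges.

saturated-permute : (s : Permutation′ k) (v : Vector (ℤⁿ n) k) (p : Fin k) →
  FacetSaturated v (s ⟨$⟩ʳ p) → FacetSaturated (rearrange (s ⟨$⟩ʳ_) v) p
saturated-permute s v p sat a u c a≢0 cp≡0 au≗ x =
  subst (λ y → a ∣ c y) (inverseˡ s)
    (sat a u (rearrange (s ⟨$⟩ˡ_) c) a≢0 (trans (cong c (inverseˡ s)) cp≡0)
      (λ t → trans (au≗ t) (combℤ-permute s c v t)) (s ⟨$⟩ʳ x))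

span-permute : (s : Permutation′ k) (v : Vector (ℤⁿ n) k) →
  ℤ-Span (rearrange (s ⟨$⟩ʳ_) v) ⊆ ℤ-Span v
span-permute s v (c , eq) = rearrange (s ⟨$⟩ˡ_) c , λ t → trans (eq t) (combℤ-permute s c v t)

span-permute⁻¹ : (s : Permutation′ k) (v : Vector (ℤⁿ n) k) →
  ℤ-Span v ⊆ ℤ-Span (rearrange (s ⟨$⟩ʳ_) v)
span-permute⁻¹ s v (c , eq) = rearrange (s ⟨$⟩ʳ_) c ,
  λ t → trans (eq t) (∑ℤ.sum-permute (λ x → c x * v x t) s)

lattice-permute : (s : Permutation′ k) (v : Vector (ℤⁿ n) k) →
  ∀ u → u ∈ Lattice (rearrange (s ⟨$⟩ʳ_) v) → u ∈ Lattice v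
lattice-permute s v u (c , eq) = rearrange (s ⟨$⟩ˡ_) c , λ t → trans (eq t) (combℚ-permute s c (map embed v) t)

lattice-permute⁻¹ : (s : Permutation′ k) (v : Vector (ℤⁿ n) k) →
  ∀ u → u ∈ Lattice v → u ∈ Lattice (rearrange (s ⟨$⟩ʳ_) v)
lattice-permute⁻¹ s v u (c , eq) = rearrange (s ⟨$⟩ʳ_) c ,
  λ t → trans (eq t) (∑ℚ.sum-permute (λ x → c x ℚ.* embed (v x) t) s)

-- Positive integers and residues.

0<⇒≢0 : ∀ {a} → 0ℤ ℤ.< a → a ≢ 0ℤ
0<⇒≢0 0<a refl = ℤ.<-irrefl refl 0<a

∣-antisym-positive : ∀ {a b} → 0ℤ ℤ.< a → 0ℤ ℤ.< b → a ∣ b → b ∣ a → a ≡ b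
∣-antisym-positive {+ _} {+ _} _ _ a∣b b∣a = cong +_ (ℕ∣.∣-antisym (∣⇒∣ᵤ a∣b) (∣⇒∣ᵤ b∣a))
∣-antisym-positive {ℤ.-[1+ _ ]} ()
∣-antisym-positive {+ _} {ℤ.-[1+ _ ]} _ ()

residues-unique : ∀ {N a b} → 0ℤ ℤ.≤ a → a ℤ.< N → 0ℤ ℤ.≤ b → b ℤ.< N → N ∣ a - b → a ≡ b
residues-unique {+ N} {+ a} {+ b} _ (+<+ a<N) _ (+<+ b<N) N∣a-b = ℤ.i-j≡0⇒i≡j (+ a) (+ b) a-b≡0
  where
  ∣a-b∣<N : ℤ.∣ + a - + b ∣ ℕ.< N
  -- For nonnegative integers the distance is at most their maximum; a multiple of `N` below `N` in
  -- absolute value is 0.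
  ∣a-b∣<N = ℕ.≤-<-trans
    (ℕ.≤-trans (ℕ.≤-reflexive (cong ℤ.∣_∣ (ℤ.m-n≡m⊖n a b))) (ℤ.∣m⊝n∣≤m⊔n a b))
    (ℕ.⊔-lub a<N b<N)
  a-b≡0 : + a - + b ≡ 0ℤ
  a-b≡0 with ℤ.∣ + a - + b ∣ in eq | ∣a-b∣<N | ∣⇒∣ᵤ N∣a-b
  ... | zero  | _  | _   = ℤ.∣i∣≡0⇒i≡0 eq
  ... | suc _ | <N | N∣ = contradiction (ℕ∣.∣⇒≤ N∣) (ℕ.<⇒≱ <N)
residues-unique {ℤ.-[1+ _ ]} {+ _} _ ()
residues-unique {a = ℤ.-[1+ _ ]} ()
residues-unique {a = + _} {ℤ.-[1+ _ ]} _ _ ()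

≢last⇒<last : (x : Fin (suc k)) → x ≢ fromℕ k → x < fromℕ k
≢last⇒<last x x≢k = ℕ.≤∧≢⇒< (Fin.≤fromℕ x) (x≢k ∘ Fin.toℕ-injective)

-- Relations between the edges and the Hermite basis of a cone.

module _ {α : OrderedCone n k} (A : IARCTAN α) where
  open OrderedCone α
  open IARCTAN A hiding (lsin; lcos)
  open IsℤBasis isBasis using () renaming (independent to basis-independent)

  -- Both sides of the relation are expanded in the Hermite basis, where coefficients are unique.
  coordinates : ∀ a u b c → (λ t → a * u t) ≗ combℤ c edge → u ≗ combℤ b basis →
    ∀ z → a * b z ≡ ∑ℤ.sum (λ y → c y * entry z y)
  coordinates a u b c au≗ u≗ = independent⇒injective basis basis-independent _ _ λ t → begin
    combℤ (λ z → a * b z) basis t  ≡⟨ combℤ-scale a b basis t ⟨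
    a * combℤ b basis t            ≡⟨ cong (a *_) (u≗ t) ⟨
    a * u t                        ≡⟨ au≗ t ⟩
    combℤ c edge t                 ≡⟨ combℤ-combℤ c entry edge basis expansion t ⟩
    combℤ (λ z → ∑ℤ.sum (λ y → c y * entry z y)) basis t ∎
    where open ≡-Reasoning

  -- The edge coefficients of `entry x x * basis x` once all earlier basis vectors are edges: v_x
  -- minus the sum of a_{y,x} v_y over y < x. The terms with y > x vanish by triangularity.
  diagonalCoeff : Fin k → Vector ℤ k
  diagonalCoeff x y with y Fin.≟ x
  ... | yes _ = 1ℤ
  ... | no  _ = - entry y x

  diagonalCoeff-≡ : ∀ x → diagonalCoeff x x ≡ 1ℤ
  diagonalCoeff-≡ x with x Fin.≟ x
  ... | yes _   = refl
  ... | no  x≢x = contradiction refl x≢x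

  diagonalCoeff-≢ : ∀ {x y} → y ≢ x → diagonalCoeff x y ≡ - entry y x
  diagonalCoeff-≢ {x} {y} y≢x with y Fin.≟ x
  ... | yes y≡x = contradiction y≡x y≢x
  ... | no  _   = refl

  diagonal-relation : ∀ x → (∀ y → y < x → basis y ≗ edge y) →
    (λ t → entry x x * basis x t) ≗ combℤ (diagonalCoeff x) edge
  -- Adding `edge x t` to both sides lets its expansion in the basis and the desired combination
  -- merge into the single sum of `f`, whose terms cancel except at `x`.
  diagonal-relation x below t = +-cancelˡ (edge x t) _ _ (begin
    edge x t + entry x x * basis x t
      ≡⟨ ℤ.+-comm (edge x t) _ ⟩
    entry x x * basis x t + edge x t
      ≡⟨ cong (_+_ (entry x x * basis x t)) (trans (sym (ℤ.*-identityˡ _)) (cong (_* edge x t) (sym (diagonalCoeff-≡ x)))) ⟩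
    f x
      ≡⟨ sum-single f x off ⟨
    ∑ℤ.sum f
      ≡⟨ ∑ℤ.∑-distrib-+ (λ y → entry y x * basis y t) (λ y → diagonalCoeff x y * edge y t) ⟩
    combℤ (λ y → entry y x) basis t + combℤ (diagonalCoeff x) edge t
      ≡⟨ cong (_+ combℤ (diagonalCoeff x) edge t) (expansion x t) ⟨
    edge x t + combℤ (diagonalCoeff x) edge t ∎)
    where
    open ≡-Reasoning
    f : Vector ℤ k
    f y = entry y x * basis y t + diagonalCoeff x y * edge y t
    cancel : ∀ a w → a * w + - a * w ≡ 0ℤ
    cancel = solve-∀
    vanish : ∀ b w → 0ℤ * b + - 0ℤ * w ≡ 0ℤ
    vanish = solve-∀
    off : ∀ y → y ≢ x → f y ≡ 0ℤ
    off y y≢x rewrite diagonalCoeff-≢ y≢x with Fin.<-cmp y x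
    ... | tri< y<x _ _ rewrite below y y<x t = cancel (entry y x) (edge y t)
    ... | tri≈ _ y≡x _ = contradiction y≡x y≢x
    ... | tri> _ _ x<y rewrite triangular x<y = vanish (basis y t) (edge y t)

  record UnitColumn (x : Fin k) : Set where
    field
      diagonal≡1  : entry x x ≡ 1ℤ
      off≡0       : ∀ y → y ≢ x → entry y x ≡ 0ℤ
      basis≗edge  : basis x ≗ edge x

  -- Normalisation confines the entries above a diagonal 1 to 0 ≤ a < 1, so they vanish.
  unitColumn : ∀ {x} → entry x x ≡ 1ℤ → UnitColumn x
  unitColumn {x} diag = record { diagonal≡1 = diag ; off≡0 = off ; basis≗edge = eq }
    where
    off : ∀ y → y ≢ x → entry y x ≡ 0ℤ
    off y y≢x with Fin.<-cmp y x
    ... | tri< y<x _ _ = ℤ.≤-antisym (ℤ.i<j⇒i≤pred[j] (subst (entry y x ℤ.<_) diag (proj₂ (normalised y<x)))) (proj₁ (normalised y<x))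
    ... | tri≈ _ y≡x _ = contradiction y≡x y≢x
    ... | tri> _ _ x<y = triangular x<y
    eq : basis x ≗ edge x
    eq t = sym (begin
      edge x t                         ≡⟨ expansion x t ⟩
      combℤ (λ y → entry y x) basis t  ≡⟨ sum-single _ x (λ y y≢x → trans (cong (_* basis y t) (off y y≢x)) (ℤ.*-zeroˡ (basis y t))) ⟩
      entry x x * basis x t            ≡⟨ cong (_* basis x t) diag ⟩
      1ℤ * basis x t                   ≡⟨ ℤ.*-identityˡ _ ⟩
      basis x t                        ∎)
      where open ≡-Reasoning

-- The Hermite form of a cone whose last facet is saturated.

module _ {α : OrderedCone n (suc k)} (A : IARCTAN α)
         (sat : FacetSaturated (OrderedCone.edge α) (fromℕ k)) where
  open OrderedCone α
  open IARCTAN A hiding (lsin; lcos)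
  open IsℤBasis isBasis using (spanning)

  private
    last = fromℕ k
    N = lsin A last

  -- By well-founded induction the earlier basis vectors are edges, so `entry x x * basis x` is a
  -- combination of edges without the last one. Saturation makes `entry x x` divide all
  -- coefficients, in particular the coefficient 1 of v_x.
  unitColumns : ∀ x → x ≢ last → UnitColumn A x
  unitColumns x = go x (<-wellFounded x)
    where
    go : ∀ x → Acc _<_ x → x ≢ last → UnitColumn A x
    go x (acc rec) x≢last = unitColumn A
      (∣-antisym-positive (positive x) (+<+ (s≤s z≤n))
        (subst (entry x x ∣_) (diagonalCoeff-≡ A x)
          (sat (entry x x) (basis x) (diagonalCoeff A x) (0<⇒≢0 (positive x)) last≡0
            (diagonal-relation A x below) x))
        (divides (entry x x) (sym (ℤ.*-identityʳ _))))
      where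
      x<last : x < last
      x<last = ≢last⇒<last x x≢last
      below : ∀ y → y < x → basis y ≗ edge y
      below y y<x = UnitColumn.basis≗edge (go y (rec y<x) (Fin.<⇒≢ (Fin.<-trans y<x x<last)))
      last≡0 : diagonalCoeff A x last ≡ 0ℤ
      last≡0 = trans (diagonalCoeff-≢ A (x≢last ∘ sym)) (cong -_ (triangular x<last))

  last-relation : (λ t → N * basis last t) ≗ combℤ (diagonalCoeff A last) edge
  last-relation = diagonal-relation A last
    λ y y<last → UnitColumn.basis≗edge (unitColumns y (Fin.<⇒≢ y<last))

  -- It suffices to treat the basis: `last-relation` handles the last vector, and the others are
  -- already edges.
  lsin-annihilates : ∀ u → u ∈ Lattice edge → (λ t → N * u t) ∈ ℤ-Span edge
  lsin-annihilates u u∈Γ with spanning u u∈Γ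
  ... | b , u≗ = proj₁ combination , λ t → begin
    N * u t                                ≡⟨ cong (N *_) (u≗ t) ⟩
    N * combℤ b basis t                    ≡⟨ Σℤ.*-distribˡ-sum N (λ i → b i * basis i t) ⟩
    ∑ℤ.sum (λ i → N * (b i * basis i t))   ≡⟨ ∑ℤ.sum-cong-≗ (λ i → swap N (b i) (basis i t)) ⟩
    combℤ b (λ i t → N * basis i t) t      ≡⟨ proj₂ combination t ⟩
    combℤ (proj₁ combination) edge t       ∎
    where
    open ≡-Reasoning
    swap : ∀ x y z → x * (y * z) ≡ y * (x * z)
    swap = solve-∀
    multiple : ∀ i → (λ t → N * basis i t) ∈ ℤ-Span edge
    multiple i with i Fin.≟ last
    ... | yes refl   = diagonalCoeff A last , last-relation
    ... | no  i≢last = (λ y → N * unit i y) , λ t →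
      trans (cong (N *_) (trans (UnitColumn.basis≗edge (unitColumns i i≢last) t) (sym (combℤ-unit edge i t))))
        (combℤ-scale N (unit i) edge t)
    combination : combℤ b (λ i t → N * basis i t) ∈ ℤ-Span edge
    combination = combℤ∈span b (λ i t → N * basis i t) edge multiple

  -- All columns but the last are unit vectors, so row `z` has only its diagonal 1 and its entry in
  -- the last column. The `z`-th coordinate of `N * u` is therefore the stated expression.
  coefficients-mod-lsin : ∀ u c → u ∈ Lattice edge → (λ t → N * u t) ≗ combℤ c edge →
    ∀ z → z ≢ last → N ∣ c z + c last * entry z last
  coefficients-mod-lsin u c u∈Γ Nu≗ z z≢last with spanning u u∈Γ
  ... | b , u≗ = divides (b z) (begin
    c z + c last * entry z last             ≡⟨ cong (_+ c last * entry z last) (ℤ.*-identityʳ (c z)) ⟨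
    c z * 1ℤ + c last * entry z last        ≡⟨ cong (λ x → c z * x + c last * entry z last) (UnitColumn.diagonal≡1 (unitColumns z z≢last)) ⟨
    c z * entry z z + c last * entry z last ≡⟨ sum-pair (λ y → c y * entry z y) z≢last off ⟨
    ∑ℤ.sum (λ y → c y * entry z y)          ≡⟨ coordinates A N u b c Nu≗ u≗ z ⟨
    N * b z                                 ≡⟨ ℤ.*-comm N (b z) ⟩
    b z * N                                 ∎)
    where
    open ≡-Reasoning
    off : ∀ y → y ≢ z → y ≢ last → c y * entry z y ≡ 0ℤ
    off y y≢z y≢last = trans (cong (c y *_) (UnitColumn.off≡0 (unitColumns y y≢last) z (y≢z ∘ sym))) (ℤ.*-zeroʳ (c y))

-- Comparing the last sines of two cones.

module _ {α : OrderedCone n (suc k)} (A : IARCTAN α) where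
  open OrderedCone α
  open IARCTAN A hiding (lsin; lcos)

  -- The last row of a triangular matrix is zero off the diagonal, so the last coordinate of an edge
  -- combination is a multiple of the last sine.
  lsin-divides-order : ∀ M → (λ t → M * basis (fromℕ k) t) ∈ ℤ-Span edge → lsin A (fromℕ k) ∣ M
  lsin-divides-order M (c , M*e≗) = divides (c last) (begin
    M                                   ≡⟨ ℤ.*-identityʳ M ⟨
    M * 1ℤ                              ≡⟨ cong (M *_) (unit-≡ last) ⟨
    M * unit last last                  ≡⟨ coordinates A M _ (unit last) c M*e≗ (λ t → sym (combℤ-unit basis last t)) last ⟩
    ∑ℤ.sum (λ y → c y * entry last y)   ≡⟨ sum-single _ last (λ y y≢last → trans (cong (c y *_) (triangular (≢last⇒<last y y≢last))) (ℤ.*-zeroʳ (c y))) ⟩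
    c last * entry last last            ∎)
    where
    open ≡-Reasoning
    last = fromℕ k

-- The last sine of `B` sends the last basis vector of `A` into the span of the edges of β, hence of
-- α, and is thus a multiple of the last sine of `A`.
lsin-∣ : {α β : OrderedCone n (suc k)} (A : IARCTAN α) (B : IARCTAN β) →
  FacetSaturated (OrderedCone.edge β) (fromℕ k) →
  (∀ u → u ∈ Lattice (OrderedCone.edge α) → u ∈ Lattice (OrderedCone.edge β)) →
  ℤ-Span (OrderedCone.edge β) ⊆ ℤ-Span (OrderedCone.edge α) →
  lsin A (fromℕ k) ∣ lsin B (fromℕ k)
lsin-∣ A B sat Γ⊆ Λ⊆ = lsin-divides-order A _
  (Λ⊆ (lsin-annihilates B sat _ (Γ⊆ (IARCTAN.basis A (fromℕ _)) (IsℤBasis.member (IARCTAN.isBasis A) (fromℕ _)))))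

-- Values of a transposition.

transpose-left : (i j : Fin k) → transpose i j ⟨$⟩ʳ i ≡ j
transpose-left i j rewrite dec-true (i Fin.≟ i) refl = refl

transpose-right : (i j : Fin k) → transpose i j ⟨$⟩ʳ j ≡ i
transpose-right i j with j Fin.≟ i
... | yes j≡i = j≡i
... | no  _ rewrite dec-true (j Fin.≟ j) refl = refl

transpose-other : {i j x : Fin k} → x ≢ i → x ≢ j → transpose i j ⟨$⟩ʳ x ≡ x
transpose-other {i = i} {j} {x} x≢i x≢j
  rewrite dec-false (x Fin.≟ i) x≢i | dec-false (x Fin.≟ j) x≢j = refl

-- Sines and cosines of a reordered simple cone.

module _ {α : OrderedCone n (suc k)} (simple : Simple α) (s : Permutation′ (suc k))
         (A : IARCTAN α) (Aₛ : IARCTAN (permuteCone s α)) where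
  open OrderedCone α

  private
    last = fromℕ k
    sat = facet-lsin⇒saturated α last (simple last)
    -- The last facet of the reordered cone is the facet of α opposite to the edge `s ⟨$⟩ʳ last`.
    satₛ = saturated-permute s edge last (facet-lsin⇒saturated α _ (simple (s ⟨$⟩ʳ last)))

  lsin-permute : lsin Aₛ last ≡ lsin A last
  lsin-permute = ∣-antisym-positive (IARCTAN.positive Aₛ last) (IARCTAN.positive A last)
    (lsin-∣ Aₛ A sat (lattice-permute s edge) (span-permute⁻¹ s edge))
    (lsin-∣ A Aₛ satₛ (lattice-permute⁻¹ s edge) (span-permute s edge))

  -- The last relation of `Aₛ`, rewritten on the original edges, has coefficient
  -- `diagonalCoeff Aₛ last x` at `s ⟨$⟩ʳ x`. Since the sines agree, `coefficients-mod-lsin` for `A`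
  -- applies to it.
  lcos-permute : ∀ x → s ⟨$⟩ʳ x ≢ last →
    lsin A last ∣ diagonalCoeff Aₛ last x
      + diagonalCoeff Aₛ last (s ⟨$⟩ˡ last) * lcos A (s ⟨$⟩ʳ x) last
  lcos-permute x sx≢last = subst
    (λ y → lsin A last ∣ diagonalCoeff Aₛ last y
      + diagonalCoeff Aₛ last (s ⟨$⟩ˡ last) * lcos A (s ⟨$⟩ʳ x) last)
    (inverseˡ s)
    (coefficients-mod-lsin A sat (basis last) (rearrange (s ⟨$⟩ˡ_) (diagonalCoeff Aₛ last))
      (lattice-permute s edge (basis last) (member last))
      (λ t → trans (cong (_* basis last t) (sym lsin-permute))
        (trans (last-relation Aₛ satₛ t) (combℤ-permute s (diagonalCoeff Aₛ last) edge t)))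
      (s ⟨$⟩ʳ x) sx≢last)
    where
    open IARCTAN Aₛ using (basis; isBasis)
    open IsℤBasis isBasis using (member)

  -- The last edge keeps its coefficient 1, so the cosines are congruent; as both are reduced
  -- residues, they are equal.
  lcos-permute-fixed : s ⟨$⟩ʳ last ≡ last → ∀ x → x ≢ last →
    lcos Aₛ x last ≡ lcos A (s ⟨$⟩ʳ x) last
  lcos-permute-fixed s-last x x≢last = residues-unique
    (proj₁ boundₛ) (subst (lcos Aₛ x last ℤ.<_) lsin-permute (proj₂ boundₛ))
    (proj₁ bound) (proj₂ bound)
    (subst (lsin A last ∣_) rearranged (∣m⇒∣-m (lcos-permute x sx≢last)))
    where
    open ≡-Reasoning
    s⁻¹-last : s ⟨$⟩ˡ last ≡ last
    s⁻¹-last = trans (cong (s ⟨$⟩ˡ_) (sym s-last)) (inverseˡ s)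
    sx≢last : s ⟨$⟩ʳ x ≢ last
    sx≢last sx≡last = x≢last (trans (sym (inverseˡ s)) (trans (cong (s ⟨$⟩ˡ_) sx≡last) s⁻¹-last))
    boundₛ = IARCTAN.normalised Aₛ (≢last⇒<last x x≢last)
    bound = IARCTAN.normalised A (≢last⇒<last _ sx≢last)
    negate : ∀ a b → - (- a + 1ℤ * b) ≡ a - b
    negate = solve-∀
    rearranged : - (diagonalCoeff Aₛ last x + diagonalCoeff Aₛ last (s ⟨$⟩ˡ last) * lcos A (s ⟨$⟩ʳ x) last)
      ≡ lcos Aₛ x last - lcos A (s ⟨$⟩ʳ x) last
    rearranged = begin
      - (diagonalCoeff Aₛ last x + diagonalCoeff Aₛ last (s ⟨$⟩ˡ last) * lcos A (s ⟨$⟩ʳ x) last)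
        ≡⟨ cong₂ (λ p q → - (p + q * lcos A (s ⟨$⟩ʳ x) last)) (diagonalCoeff-≢ Aₛ x≢last)
             (trans (cong (diagonalCoeff Aₛ last) s⁻¹-last) (diagonalCoeff-≡ Aₛ last)) ⟩
      - (- lcos Aₛ x last + 1ℤ * lcos A (s ⟨$⟩ʳ x) last)
        ≡⟨ negate (lcos Aₛ x last) (lcos A (s ⟨$⟩ʳ x) last) ⟩
      lcos Aₛ x last - lcos A (s ⟨$⟩ʳ x) last ∎

  module _ {i} (s-i : s ⟨$⟩ʳ i ≡ last) (i≢last : i ≢ last) where

    private
      coeff-s⁻¹-last : diagonalCoeff Aₛ last (s ⟨$⟩ˡ last) ≡ - lcos Aₛ i last
      coeff-s⁻¹-last = trans
        (cong (diagonalCoeff Aₛ last) (trans (cong (s ⟨$⟩ˡ_) (sym s-i)) (inverseˡ s)))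
        (diagonalCoeff-≢ Aₛ i≢last)

    -- At position `last` the relation of `Aₛ` has coefficient 1, while v_k, now at position `i`,
    -- has minus the cosine `lcos Aₛ i last`.
    lcos-permute-inverse : ∀ y → s ⟨$⟩ʳ last ≡ y → y ≢ last →
      lcos Aₛ i last isInverseOf lcos A y last mod lsin A last
    lcos-permute-inverse y refl y≢last = subst (lsin A last ∣_) rearranged
      (∣m⇒∣-m (lcos-permute last y≢last))
      where
      negate : ∀ a c → - (1ℤ + - c * a) ≡ a * c - 1ℤ
      negate = solve-∀
      rearranged : - (diagonalCoeff Aₛ last last + diagonalCoeff Aₛ last (s ⟨$⟩ˡ last) * lcos A y last)
        ≡ lcos A y last * lcos Aₛ i last - 1ℤ
      rearranged = trans
        (cong₂ (λ p q → - (p + q * lcos A y last)) (diagonalCoeff-≡ Aₛ last) coeff-s⁻¹-last)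
        (negate (lcos A y last) (lcos Aₛ i last))

    -- Here both coefficients in the congruence are negated cosines of `Aₛ`, at `x` and at `i`.
    lcos-permute-moved : ∀ x y → s ⟨$⟩ʳ x ≡ y → x ≢ last → y ≢ last →
      lcos Aₛ x last ≡ - lcos A y last * lcos Aₛ i last [mod lsin A last ]
    lcos-permute-moved x y refl x≢last y≢last = subst (lsin A last ∣_) rearranged
      (∣m⇒∣-m (lcos-permute x y≢last))
      where
      negate : ∀ a c d → - (- d + - c * a) ≡ d - - a * c
      negate = solve-∀
      rearranged : - (diagonalCoeff Aₛ last x + diagonalCoeff Aₛ last (s ⟨$⟩ˡ last) * lcos A y last)
        ≡ lcos Aₛ x last - - lcos A y last * lcos Aₛ i last
      rearranged = trans
        (cong₂ (λ p q → - (p + q * lcos A y last)) (diagonalCoeff-≢ Aₛ x≢last) coeff-s⁻¹-last)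
        (negate (lcos A y last) (lcos Aₛ i last) (lcos Aₛ x last))

proposition3p4 : ∀ (n m : ℕ) (α : OrderedCone n (suc (suc m))) → Simple α →
    ∀ (i j : Fin (suc (suc m))) → i < j →
    let σ = transpose i j
        k = fromℕ (suc m)
    in
    ∀ (A : IARCTAN α) (Aσ : IARCTAN (permuteCone σ α)) →
      (j < k → ∀ x → x < k → lcos Aσ x k ≡ lcos A (σ ⟨$⟩ʳ x) k)
      ×
      (j ≡ k → ∃[ c ] (c isInverseOf lcos A i k mod lsin A k)
        × (∀ x → x < k →
            (x ≡ i → lcos Aσ x k ≡ c [mod lsin A k ])
            × (x ≢ i → lcos Aσ x k ≡ - lcos A x k * c [mod lsin A k ])))
proposition3p4 n m α simple i j i<j A Aσ =
    (λ j<k x x<k → lcos-permute-fixed simple (transpose i j) A Aσ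
      (transpose-other (Fin.<⇒≢ (Fin.<-trans i<j j<k) ∘ sym) (Fin.<⇒≢ j<k ∘ sym))
      x (Fin.<⇒≢ x<k))
  -- The inverse is witnessed by the cosine of the transposed cone itself, so the case `x ≡ i` is
  -- reflexivity.
  , λ { refl → lcos Aσ i j
      , lcos-permute-inverse simple (transpose i j) A Aσ
          (transpose-left i j) i≢j i (transpose-right i j) i≢j
      , λ x x<j →
          (λ { refl → divides 0ℤ (ℤ.+-inverseʳ (lcos Aσ i j)) })
        , λ x≢i → lcos-permute-moved simple (transpose i j) A Aσ
            (transpose-left i j) i≢j x x
            (transpose-other x≢i (Fin.<⇒≢ x<j)) (Fin.<⇒≢ x<j) (Fin.<⇒≢ x<j) }
  where
  i≢j : i ≢ j
  i≢j = Fin.<⇒≢ i<j
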